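{- Every finite tournament is a subtournament of a finite regular tournament. That is, for every finite tournament $T$ there exist a finite regular tournament $R$ and an injective map $f$ from the vertex set of $T$ to the vertex set of $R$ such that for all vertices $x,y$ of $T$, $x\to y$ in $T$ if and only if $f(x)\to f(y)$ in $R$.
   Context: A tournament is a pair $T=(V,E)$, where $V$ is a finite nonempty set of vertices and $E\subseteq V\times V$ is a relation such that $(v,v)\notin E$ for all $v$, and for any two distinct $u,v\in V$ exactly one of $(u,v)\in E$, $(v,u)\in E$ holds. We write $u\to v$ when $(u,v)\in E$. For a vertex $v$, the indegree is $\mathrm{in}(v)=|\{u\in V: u\to v\}|$ and the outdegree is $\mathrm{out}(v)=|\{u\in V: v\to u\}|$. A tournament is regular if $\mathrm{in}(v)=\mathrm{out}(v)$ for every vertex $v$. -}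

module Defs where

open import Data.Fin.Base using (Fin)
open import Data.Fin.Subset using (Subset; ∣_∣)
open import Data.Fin.Properties using () renaming (_≟_ to _≟ᶠ_)
open import Data.Nat.Base using (ℕ)
open import Data.Product.Base using (_×_; _,_)
open import Data.Sum.Base using (_⊎_; inj₁; inj₂)
open import Data.Vec.Base using (tabulate)
open import Function.Bundles using (_↔_; Inverse)
open import Function.Properties.Inverse using (↔⇒↣)
open import Level using (0ℓ)
open import Relation.Binary.Core using (Rel)
open import Relation.Binary.Definitions using (Decidable; DecidableEquality)
open import Relation.Binary.PropositionalEquality using (_≡_; _≢_; refl)
open import Relation.Nullary.Decidable using (yes; no; does; via-injection)
open import Relation.Nullary.Negation using (¬_)
import Relation.Unary as Unary

record Tournament : Set₁ where
  infix 4 _⟶_ _≟_ _⟶?_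
  field
    V        : Set
    order    : ℕ
    finite   : V ↔ Fin order
    nonempty : V
    _⟶_      : Rel V 0ℓ
    irrefl   : ∀ v → ¬ (v ⟶ v)
    exactly-one : ∀ u v → u ≢ v →
                  ((u ⟶ v) × ¬ (v ⟶ u)) ⊎ (¬ (u ⟶ v) × (v ⟶ u))

  _≟_ : DecidableEquality V
  _≟_ = via-injection (↔⇒↣ finite) _≟ᶠ_

  -- Decidability of the arcs is a consequence of the axioms, not an extra
  -- assumption; it is what makes the degrees computable.
  _⟶?_ : Decidable _⟶_
  u ⟶? v with u ≟ v
  ... | yes refl = no (irrefl v)
  ... | no u≢v with exactly-one u v u≢v
  ...   | inj₁ (u⟶v , _) = yes u⟶v
  ...   | inj₂ (¬u⟶v , _) = no ¬u⟶v

  -- ⟦ P? ⟧ is { u ∈ V ∣ P u }, transported along the bijection V ↔ Fin order.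
  ⟦_⟧ : {P : Unary.Pred V 0ℓ} → Unary.Decidable P → Subset order
  ⟦ P? ⟧ = tabulate λ i → does (P? (Inverse.from finite i))

  indegree : V → ℕ
  indegree v = ∣ ⟦ (λ u → u ⟶? v) ⟧ ∣

  outdegree : V → ℕ
  outdegree v = ∣ ⟦ (λ u → v ⟶? u) ⟧ ∣

Regular : Tournament → Set
Regular T = ∀ v → indegree v ≡ outdegree v
  where open Tournament T

{-# OPTIONS --safe #-}
-- Put two copies `low`, `high` of T together with one extra vertex ∞. Each copy
-- keeps the arcs of T; between the copies, arcs joining distinct vertices of T
-- are reversed, so that those at x contribute in(x) + out(x) to both of its
-- degrees. The remaining arcs form the 3-cycles low x ⟶ high x ⟶ ∞ ⟶ low x.
-- Regularity is witnessed, at each vertex v, by an involution exchanging the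
-- in-neighbours and the out-neighbours of v.
module Submission where

open import Defs
open import Data.Bool.Base using (Bool; true; false; if_then_else_)
open import Data.Fin.Base using (Fin; zero; suc)
open import Data.Fin.Permutation using (Permutation′; _⟨$⟩ʳ_)
open import Data.Fin.Properties using (1↔⊤; +↔⊎)
open import Data.Fin.Subset using (∣_∣)
open import Data.Nat.Base using (ℕ; suc; _+_)
open import Data.Nat.Properties using (+-0-commutativeMonoid)
open import Data.Product using (Σ-syntax; _×_; _,_)
open import Data.Sum.Base using (_⊎_; inj₁; inj₂)
open import Data.Sum.Function.Propositional using (_⊎-↔_)
open import Data.Sum.Properties using (inj₁-injective; inj₂-injective)
open import Data.Unit.Base using (⊤; tt)
open import Data.Vec.Base using (tabulate)
open import Data.Vec.Properties using (tabulate-cong)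
open import Function.Base using (_∘_)
open import Function.Bundles using (_⇔_; _↔_; mk⇔; mk↔ₛ′; Inverse)
open import Function.Construct.Composition using (_↔-∘_)
open import Function.Definitions using (Injective)
open import Function.Properties.Inverse using (↔-sym)
open import Relation.Binary.PropositionalEquality
  using (_≡_; _≢_; refl; sym; cong; subst; module ≡-Reasoning)
open import Relation.Nullary.Decidable using (yes; no; does; does-⇔)
open import Relation.Nullary.Negation using (¬_; contradiction)
open import Algebra.Properties.CommutativeMonoid.Sum +-0-commutativeMonoid
  using (sum; sum-permute)
open Tournament using (V)

-- Turns cardinalities into sums, whose invariance under permutations is `sum-permute`.
∣tabulate∣-sum : ∀ {n} (f : Fin n → Bool) →
                 ∣ tabulate f ∣ ≡ sum (λ i → if f i then 1 else 0)
∣tabulate∣-sum {ℕ.zero} f = refl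
∣tabulate∣-sum {suc n}  f with f zero
... | true  = cong suc (∣tabulate∣-sum (f ∘ suc))
... | false = ∣tabulate∣-sum (f ∘ suc)

∣tabulate∣-permute : ∀ {n} (f : Fin n → Bool) (π : Permutation′ n) →
                     ∣ tabulate f ∣ ≡ ∣ tabulate (f ∘ (π ⟨$⟩ʳ_)) ∣
∣tabulate∣-permute f π = begin
  ∣ tabulate f ∣                             ≡⟨ ∣tabulate∣-sum f ⟩
  sum (λ i → if f i then 1 else 0)           ≡⟨ sum-permute _ π ⟩
  sum (λ i → if f (π ⟨$⟩ʳ i) then 1 else 0)  ≡⟨ ∣tabulate∣-sum (f ∘ (π ⟨$⟩ʳ_)) ⟨
  ∣ tabulate (f ∘ (π ⟨$⟩ʳ_)) ∣               ∎
  where open ≡-Reasoning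

module _ (T : Tournament) where
  open Tournament T hiding (V)

  -- Involutivity upgrades the two implications to an equivalence between `u ⟶ v` and `v ⟶ σ u`, so
  -- the characteristic vectors of the two neighbourhoods differ by a permutation of indices.
  involution⇒balanced : ∀ v (σ : V T → V T) → (∀ u → σ (σ u) ≡ u) →
                        (∀ {u} → u ⟶ v → v ⟶ σ u) →
                        (∀ {u} → v ⟶ u → σ u ⟶ v) →
                        indegree v ≡ outdegree v
  involution⇒balanced v σ σ-involutive in⇒out out⇒in = begin
    ∣ tabulate (λ i → does (from i ⟶? v)) ∣             ≡⟨ cong ∣_∣ (tabulate-cong does-≡) ⟩
    ∣ tabulate (λ i → does (v ⟶? from (π ⟨$⟩ʳ i))) ∣  ≡⟨ ∣tabulate∣-permute _ π ⟨
    ∣ tabulate (λ i → does (v ⟶? from i)) ∣             ∎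
    where
    open ≡-Reasoning
    open Inverse finite using (from; strictlyInverseʳ)

    -- The conjugate of `σ` by the enumeration of the vertices.
    π : Permutation′ order
    π = finite ↔-∘ (mk↔ₛ′ σ σ σ-involutive σ-involutive ↔-∘ ↔-sym finite)

    from-π : ∀ i → σ (from i) ≡ from (π ⟨$⟩ʳ i)
    from-π i = sym (strictlyInverseʳ (σ (from i)))

    does-≡ : ∀ i → does (from i ⟶? v) ≡ does (v ⟶? from (π ⟨$⟩ʳ i))
    does-≡ i = does-⇔ (mk⇔
      (λ u⟶v → subst (v ⟶_) (from-π i) (in⇒out u⟶v))
      (λ v⟶σu → subst (_⟶ v) (σ-involutive (from i))
        (out⇒in (subst (v ⟶_) (sym (from-π i)) v⟶σu))))
      (from i ⟶? v) (v ⟶? from (π ⟨$⟩ʳ i))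

module Doubling (T : Tournament) where
  open Tournament T hiding (V)

  -- A sum, so that the bijection with `Fin (1 + (order + order))` can be composed summand by
  -- summand.
  Vertex : Set
  Vertex = ⊤ ⊎ (V T ⊎ V T)

  pattern ∞      = inj₁ tt
  pattern low x  = inj₂ (inj₁ x)
  pattern high x = inj₂ (inj₂ x)

  infix 4 _⇒_
  -- Since `_⟶_` is irreflexive, `low-high` and `high-low` never join the two copies of one vertex,
  -- which leaves that pair to `rung`.
  data _⇒_ : Vertex → Vertex → Set where
    low-low   : ∀ {x y} → x ⟶ y → low x ⇒ low y
    high-high : ∀ {x y} → x ⟶ y → high x ⇒ high y
    low-high  : ∀ {x y} → y ⟶ x → low x ⇒ high y
    high-low  : ∀ {x y} → y ⟶ x → high x ⇒ low y
    rung      : ∀ {x} → low x ⇒ high x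
    exit      : ∀ {x} → high x ⇒ ∞
    enter     : ∀ {x} → ∞ ⇒ low x

  ⇒-irrefl : ∀ v → ¬ (v ⇒ v)
  ⇒-irrefl (low x)  (low-low x⟶x)   = irrefl x x⟶x
  ⇒-irrefl (high x) (high-high x⟶x) = irrefl x x⟶x

  ExactlyOne : Vertex → Vertex → Set
  ExactlyOne u v = ((u ⇒ v) × ¬ (v ⇒ u)) ⊎ (¬ (u ⇒ v) × (v ⇒ u))

  ExactlyOne-sym : ∀ {u v} → ExactlyOne u v → ExactlyOne v u
  ExactlyOne-sym (inj₁ (u⇒v , v⇏u)) = inj₂ (v⇏u , u⇒v)
  ExactlyOne-sym (inj₂ (u⇏v , v⇒u)) = inj₁ (v⇒u , u⇏v)

  ⇒-low-high : ∀ x y → ExactlyOne (low x) (high y)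
  ⇒-low-high x y with x ≟ y
  ... | yes refl = inj₁ (rung , λ { (high-low x⟶x) → irrefl x x⟶x })
  ... | no x≢y with exactly-one x y x≢y
  ...   | inj₁ (x⟶y , y↛x) =
            inj₂ ((λ { (low-high y⟶x) → y↛x y⟶x ; rung → x≢y refl }) , high-low x⟶y)
  ...   | inj₂ (x↛y , y⟶x) = inj₁ (low-high y⟶x , λ { (high-low x⟶y) → x↛y x⟶y })

  ⇒-exactly-one : ∀ u v → u ≢ v → ExactlyOne u v
  ⇒-exactly-one ∞        ∞        u≢v = contradiction refl u≢v
  ⇒-exactly-one ∞        (low y)  _   = inj₁ (enter , λ ())
  ⇒-exactly-one ∞        (high y) _   = inj₂ ((λ ()) , exit)
  ⇒-exactly-one (low x)  ∞        _   = inj₂ ((λ ()) , enter)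
  ⇒-exactly-one (high x) ∞        _   = inj₁ (exit , λ ())
  ⇒-exactly-one (low x)  (high y) _   = ⇒-low-high x y
  ⇒-exactly-one (high x) (low y)  _   = ExactlyOne-sym (⇒-low-high y x)
  ⇒-exactly-one (low x)  (low y)  u≢v with exactly-one x y (u≢v ∘ cong (λ z → low z))
  ... | inj₁ (x⟶y , y↛x) = inj₁ (low-low x⟶y , λ { (low-low y⟶x) → y↛x y⟶x })
  ... | inj₂ (x↛y , y⟶x) = inj₂ ((λ { (low-low x⟶y) → x↛y x⟶y }) , low-low y⟶x)
  ⇒-exactly-one (high x) (high y) u≢v with exactly-one x y (u≢v ∘ cong (λ z → high z))
  ... | inj₁ (x⟶y , y↛x) = inj₁ (high-high x⟶y , λ { (high-high y⟶x) → y↛x y⟶x })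
  ... | inj₂ (x↛y , y⟶x) = inj₂ ((λ { (high-high x⟶y) → x↛y x⟶y }) , high-high y⟶x)

  double : Tournament
  double = record
    { V           = Vertex
    ; order       = 1 + (order + order)
    ; finite      = ↔-sym +↔⊎ ↔-∘ (↔-sym 1↔⊤ ⊎-↔ (↔-sym +↔⊎ ↔-∘ (finite ⊎-↔ finite)))
    ; nonempty    = ∞
    ; _⟶_         = _⇒_
    ; irrefl      = ⇒-irrefl
    ; exactly-one = ⇒-exactly-one
    }

  -- Swaps the two copies, except on the 3-cycle through the centre v, where it
  -- fixes v and swaps the other two vertices.
  opposite : Vertex → Vertex → Vertex
  opposite ∞        ∞        = ∞
  opposite ∞        (low y)  = high y
  opposite ∞        (high y) = low y
  opposite (low x)  ∞        = high x
  opposite (low x)  (low y)  with y ≟ x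
  ... | yes _ = low y
  ... | no  _ = high y
  opposite (low x)  (high y) with y ≟ x
  ... | yes _ = ∞
  ... | no  _ = low y
  opposite (high x) ∞        = low x
  opposite (high x) (low y)  with y ≟ x
  ... | yes _ = ∞
  ... | no  _ = high y
  opposite (high x) (high y) with y ≟ x
  ... | yes _ = high y
  ... | no  _ = low y

  -- Off the 3-cycle, and at the centre itself, the underlying vertex `y` is kept, so the second
  -- application repeats the test `y ≟ x` with the same outcome `eq`.
  opposite-involutive : ∀ v u → opposite v (opposite v u) ≡ u
  opposite-involutive ∞        ∞        = refl
  opposite-involutive ∞        (low y)  = refl
  opposite-involutive ∞        (high y) = refl
  -- The second application meets `high x` and tests `x ≟ x`, which does not reduce for an abstract
  -- `T`.
  opposite-involutive (low x)  ∞        with x ≟ x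
  ... | yes _   = refl
  ... | no  x≢x = contradiction refl x≢x
  opposite-involutive (low x)  (low y)  with y ≟ x in eq
  ... | yes _    rewrite eq = refl
  ... | no  _    rewrite eq = refl
  opposite-involutive (low x)  (high y) with y ≟ x in eq
  -- Passing through `∞` forgets `y` and returns `high x`, so the equality itself is needed.
  ... | yes refl = refl
  ... | no  _    rewrite eq = refl
  opposite-involutive (high x) ∞        with x ≟ x
  ... | yes _   = refl
  ... | no  x≢x = contradiction refl x≢x
  opposite-involutive (high x) (low y)  with y ≟ x in eq
  ... | yes refl = refl
  ... | no  _    rewrite eq = refl
  opposite-involutive (high x) (high y) with y ≟ x in eq
  ... | yes _    rewrite eq = refl
  ... | no  _    rewrite eq = refl

  -- Arcs between the copies are reversed, so moving `u` to the other copy flips its arc with `v`;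
  -- on the 3-cycle, the predecessor of `v` goes to its successor.
  in⇒out : ∀ v {u} → u ⇒ v → v ⇒ opposite v u
  in⇒out ∞        exit  = enter
  in⇒out (low x)  enter = rung
  in⇒out (low x)  {low y} (low-low y⟶x) with y ≟ x
  ... | yes refl = contradiction y⟶x (irrefl y)
  ... | no  _    = low-high y⟶x
  in⇒out (low x)  {high y} (high-low x⟶y) with y ≟ x
  ... | yes refl = contradiction x⟶y (irrefl x)
  ... | no  _    = low-low x⟶y
  in⇒out (high x) {high y} (high-high y⟶x) with y ≟ x
  ... | yes refl = contradiction y⟶x (irrefl y)
  ... | no  _    = high-low y⟶x
  in⇒out (high x) {low y} (low-high x⟶y) with y ≟ x
  -- The arc `x⟶y` would be a loop here, but the goal `high x ⇒ ∞` holds outright.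
  ... | yes refl = exit
  ... | no  _    = high-high x⟶y
  in⇒out (high x) rung with x ≟ x
  ... | yes _   = exit
  ... | no  x≢x = contradiction refl x≢x

  out⇒in : ∀ v {u} → v ⇒ u → opposite v u ⇒ v
  out⇒in ∞        enter = exit
  out⇒in (high x) exit  = rung
  out⇒in (low x)  {low y} (low-low x⟶y) with y ≟ x
  ... | yes refl = contradiction x⟶y (irrefl x)
  ... | no  _    = high-low x⟶y
  out⇒in (low x)  {high y} (low-high y⟶x) with y ≟ x
  ... | yes refl = enter
  ... | no  _    = low-low y⟶x
  out⇒in (low x)  rung with x ≟ x
  ... | yes _   = enter
  ... | no  x≢x = contradiction refl x≢x
  out⇒in (high x) {high y} (high-high x⟶y) with y ≟ x
  ... | yes refl = contradiction x⟶y (irrefl x)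
  ... | no  _    = low-high x⟶y
  out⇒in (high x) {low y} (high-low y⟶x) with y ≟ x
  ... | yes refl = contradiction y⟶x (irrefl y)
  ... | no  _    = high-high y⟶x

  double-regular : Regular double
  double-regular v = involution⇒balanced double v (opposite v)
    (opposite-involutive v) (in⇒out v) (out⇒in v)

theorem3p3 : (T : Tournament) →
    Σ[ R ∈ Tournament ] Regular R ×
    (Σ[ f ∈ (V T → V R) ] Injective _≡_ _≡_ f ×
    (∀ x y → Tournament._⟶_ T x y ⇔ Tournament._⟶_ R (f x) (f y)))
theorem3p3 T = double , double-regular , (λ x → low x) ,
  (λ eq → inj₁-injective (inj₂-injective eq)) ,
  -- `low-low` is the only constructor joining two low vertices, so an arc between them comes from
  -- `T`.
  λ x y → mk⇔ low-low (λ { (low-low x⟶y) → x⟶y })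
  where open Doubling T
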